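{- Let $p$ be a positive rational prime. The family $\mathcal{F}_p$ of irreducible polynomials associated with $p$ can be generated from the seed polynomial $\Phi_p(x)=x^{p-1}+\cdots+x+1$ by the following rules (that is, every element of $\mathcal{F}_p$ can be obtained from $\Phi_p(x)$ by applying these rules): (1) the ascent procedure, which converts $f_p^{(b)}(x)$ into $f_p^{(b+a)}(x)$ for $a,b\in\mathbb{N}$ (note $f_p^{(1)}=\Phi_p$); (2) replacing selected coefficients $a_i$ of a polynomial $f_p^{(b)}(x)$ by the linear digit $x-(b-a_i)$ (i.e. replacing the term $a_ix^i$ by $(x-(b-a_i))x^i$ for all $i$ in some finite set of indices); this can be done for finitely many zero coefficients as well, including those associated with $x^n$ where $n>\deg f_p^{(b)}(x)$.
   Context: $\mathbb{N}$ is the set of positive integers. For $c\in\mathbb{N}$: $f_c^{(1)}(x)=x^{c-1}+\cdots+x+1$, and for $b\ge2$, $f_c^{(b)}(x)=\sum a_ix^i$ where $c=\sum a_ib^i$ is the base-$b$ expansion of $c$ (digits $0\le a_i\le b-1$). A polynomial in $\mathbb{Z}[x]$ is positive if its leading coefficient is positive; a non-constant polynomial is proper if the gcd of its values at all integers is $1$; a PPI-polynomial is a (non-constant) positive, proper polynomial irreducible in $\mathbb{Z}[x]$. Every positive polynomial $g$ has a unique base-$x$ representation $\sum_{i=0}^m b_i(x)x^i$ with digits $b_i(x)\in\{0,1,2,\dots\}\cup\{x-1,x-2,\dots\}$, $b_m(x)\ne0$; $\mathrm{MB}(g)$ is the least positive integer $a$ such that all its digits lie in $\{0,\dots,a-1\}\cup\{x-1,\dots,x-a\}$.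 $\mathcal{F}_p$ is the set consisting of the constant polynomial $p$, the cyclotomic polynomial $\Phi_p(x)$, and every PPI-polynomial $g(x)\in\mathbb{Z}[x]$ such that $g(b)=p$ for some integer $b\ge \mathrm{MB}(g)$. Ascent procedure from base $b$ to base $b+a$ applied to $f=f_c^{(b)}$: (a) form $f(x-a)$ and simplify; (b) replace each nonzero coefficient $\pm n$ ($n>0$) by $\pm f_n^{(b+a)}(x)$ and simplify; (c) if every coefficient now has absolute value strictly less than $b+a$, go to (d), otherwise return to (b); (d) write the polynomial in base $x$, replace each digit of the form $x-j$ by $b+a-j$, and simplify. -}

module Defs where

open import Algebra.Bundles.Raw using (RawSemiring)
import Algebra.Definitions.RawSemiring as RawSemiringDefinitions
open import Data.Digit using (toDigits)
open import Data.Fin.Base using (toℕ)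
open import Data.Fin.Subset using (Subset; inside; outside)
open import Data.Integer.Base as ℤ using (ℤ; +_; -[1+_]; 0ℤ; 1ℤ; ∣_∣)
import Data.Integer.Divisibility as ℤ
open import Data.List.Base using (List; []; _∷_; _∷ʳ_; map; replicate; foldr)
open import Data.List.Relation.Unary.All using (All)
open import Data.Nat.Base as ℕ using (ℕ; suc)
open import Data.Product.Base using (_×_; ∃; ∃-syntax; proj₁)
open import Data.Vec.Base as Vec using ()
open import Level using (0ℓ)
open import Relation.Binary.PropositionalEquality using (_≡_; _≢_)
open import Relation.Nullary.Negation using (¬_)

infix  4 _≈_
infixl 6 _+_
infixl 7 _*_

-- ℤ[x]: coefficient lists, constant term first; trailing zeros are
-- permitted, so equality of polynomials is _≈_ rather than _≡_.

Poly : Set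
Poly = List ℤ

coeff : Poly → ℕ → ℤ
coeff []      _       = 0ℤ
coeff (c ∷ f) ℕ.zero  = c
coeff (c ∷ f) (suc i) = coeff f i

record _≈_ (f g : Poly) : Set where
  constructor mk≈
  field coeff-≡ : ∀ i → coeff f i ≡ coeff g i

_+_ : Poly → Poly → Poly
[]      + g       = g
f       + []      = f
(c ∷ f) + (d ∷ g) = (c ℤ.+ d) ∷ (f + g)

-_ : Poly → Poly
-_ = map (λ c → ℤ.- c)

x·_ : Poly → Poly
x· f = 0ℤ ∷ f

constant : ℤ → Poly
constant c = c ∷ []

_*_ : Poly → Poly → Poly
[]      * g = []
(c ∷ f) * g = map (λ d → c ℤ.* d) g + x· (f * g)

eval : Poly → ℤ → ℤ
eval f n = foldr (λ c v → c ℤ.+ n ℤ.* v) 0ℤ f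

_∘_ : Poly → Poly → Poly
f ∘ g = foldr (λ c h → constant c + g * h) [] f

ℤ[x] : RawSemiring 0ℓ 0ℓ
ℤ[x] = record
  { Carrier = Poly
  ; _≈_     = _≈_
  ; _+_     = _+_
  ; _*_     = _*_
  ; 0#      = []
  ; 1#      = constant 1ℤ
  }

open RawSemiringDefinitions ℤ[x] public using (Irreducible)

HasDegree : Poly → ℕ → Set
HasDegree f n = coeff f n ≢ 0ℤ × (∀ i → n ℕ.< i → coeff f i ≡ 0ℤ)

Positive : Poly → Set
Positive f = ∃[ n ] HasDegree f n × 0ℤ ℤ.< coeff f n

NonConstant : Poly → Set
NonConstant f = ∃[ n ] HasDegree f n × 1 ℕ.≤ n

GCDOfValues : Poly → ℕ → Set
GCDOfValues f d =
  (∀ n → + d ℤ.∣ eval f n) ×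
  (∀ c → (∀ n → c ℤ.∣ eval f n) → c ℤ.∣ + d)

Proper : Poly → Set
Proper f = NonConstant f × GCDOfValues f 1

PPI : Poly → Set
PPI f = Positive f × Proper f × Irreducible f

-- The polynomials f_c^(b), with b and c positive.  The clause for
-- b = 0 is a dummy.

f⟨_⟩ : ℕ → ℕ → Poly
f⟨ 0 ⟩               c = []
f⟨ 1 ⟩               c = replicate c 1ℤ
f⟨ b@(suc (suc _)) ⟩ c = map (λ a → + toℕ a) (proj₁ (toDigits b c))

-- The cyclotomic polynomial x^(p-1) + ⋯ + x + 1, for p prime.

Φ : ℕ → Poly
Φ p = replicate p 1ℤ

-- Base-x digits: nat n is the constant n, and x-[1+ j ] is the linear
-- polynomial x - (1 + j).

data Digit : Set where
  nat     : ℕ → Digit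
  x-[1+_] : ℕ → Digit

digitPoly : Digit → Poly
digitPoly (nat n)    = constant (+ n)
digitPoly x-[1+ j ] = -[1+ j ] ∷ 1ℤ ∷ []

fromBase-x : List Digit → Poly
fromBase-x = foldr (λ d f → digitPoly d + x· f) []

record BaseXRepresentation (g : Poly) (ds : List Digit) : Set where
  field
    represents  : fromBase-x ds ≈ g
    top-nonzero : ∃[ ds′ ] ∃[ d ] ds ≡ ds′ ∷ʳ d × d ≢ nat 0

-- d ∈ {0, …, a - 1} ∪ {x - 1, …, x - a}

_WithinBound_ : Digit → ℕ → Set
nat n     WithinBound a = n ℕ.< a
x-[1+ j ] WithinBound a = suc j ℕ.≤ a

DigitBound : Poly → ℕ → Set
DigitBound g a =
  1 ℕ.≤ a × ∃[ ds ] BaseXRepresentation g ds × All (_WithinBound a) ds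

-- a = MB(g).  Representations being unique, the existential in
-- DigitBound refers to the base-x representation of g.

IsMB : Poly → ℕ → Set
IsMB g a = DigitBound g a × (∀ a′ → DigitBound g a′ → a ℕ.≤ a′)

data 𝓕 (p : ℕ) (g : Poly) : Set where
  prime      : g ≈ constant (+ p) → 𝓕 p g
  cyclotomic : g ≈ Φ p → 𝓕 p g
  ppi        : ∀ {a b} → PPI g → IsMB g a → + a ℤ.≤ b → eval g b ≡ + p → 𝓕 p g

-- The ascent procedure; B stands for the target base b + a.

shift : ℕ → Poly → Poly
shift a f = f ∘ (ℤ.- (+ a) ∷ 1ℤ ∷ [])

expandCoeff : ℕ → ℤ → Poly
expandCoeff B (+ 0)       = []
expandCoeff B (+ n@(suc _)) = f⟨ B ⟩ n
expandCoeff B -[1+ n ]    = - f⟨ B ⟩ (suc n)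

expandCoeffs : ℕ → Poly → Poly
expandCoeffs B = foldr (λ c f → expandCoeff B c + x· f) []

CoeffsBelow : ℕ → Poly → Set
CoeffsBelow B = All (λ c → ∣ c ∣ ℕ.< B)

data Reduces (B : ℕ) (f : Poly) : Poly → Set where
  stop  : CoeffsBelow B (expandCoeffs B f) → Reduces B f (expandCoeffs B f)
  again : ∀ {h} → ¬ CoeffsBelow B (expandCoeffs B f) →
          Reduces B (expandCoeffs B f) h → Reduces B f h

digitAt : ℕ → Digit → ℤ
digitAt B (nat n)    = + n
digitAt B x-[1+ j ] = + B ℤ.- + suc j

record Ascent (a b : ℕ) (f h : Poly) : Set where
  field
    {reduced}  : Poly
    {digits}   : List Digit
    reduces    : Reduces (b ℕ.+ a) (shift a f) reduced
    represents : BaseXRepresentation reduced digits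
    result     : h ≈ map (digitAt (b ℕ.+ a)) digits

-- linearise b S f replaces the coefficient aᵢ of f by x - (b - aᵢ) for
-- every i in S; S may contain indices beyond the degree of f.

linearDigit : ℕ → ℤ → Poly
linearDigit b c = ℤ.- (+ b ℤ.- c) ∷ 1ℤ ∷ []

linearise : ∀ {n} → ℕ → Subset n → Poly → Poly
linearise b Vec.[]              f       = f
linearise b (outside Vec.∷ S) []      = x· linearise b S []
linearise b (outside Vec.∷ S) (c ∷ f) = c ∷ linearise b S f
linearise b (inside  Vec.∷ S) []      = linearDigit b 0ℤ + x· linearise b S []
linearise b (inside  Vec.∷ S) (c ∷ f) = linearDigit b c + x· linearise b S f

data Generated (p : ℕ) : Poly → Set where
  seed    : Generated p (Φ p)
  ascend  : ∀ {a b h} → 1 ℕ.≤ a → 1 ℕ.≤ b →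
            Generated p (f⟨ b ⟩ p) → Ascent a b (f⟨ b ⟩ p) h → Generated p h
  replace : ∀ {b n} → 1 ℕ.≤ b → (S : Subset n) →
            Generated p (f⟨ b ⟩ p) → Generated p (linearise b S (f⟨ b ⟩ p))
  respect : ∀ {g h} → g ≈ h → Generated p g → Generated p h

{-# OPTIONS --safe #-}

-- Expanding every coefficient in base B preserves the value at B and strictly
-- decreases the sum of the absolute values of the coefficients as long as some
-- coefficient is at least B in absolute value, so the ascent procedure stops.
-- Shifting by a turns the value at b into the value at B = b + a; hence the
-- polynomial obtained still takes the value p at B.  Substituting x = B in a
-- base-x representation with digits within B gives base-B digits of p, and these
-- are unique.  The same substitution shows that a PPI-polynomial g with g(b) = p
-- is f_p^(b) with the coefficients at the linear digits of g replaced.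

module Submission where

open import Defs using (Poly; f⟨_⟩; Ascent; 𝓕; Generated)
open import Defs
  using (coeff; _≈_; mk≈; x·_; constant; eval; Digit; nat; x-[1+_]; digitPoly;
         fromBase-x; BaseXRepresentation; _WithinBound_; shift; expandCoeff;
         expandCoeffs; CoeffsBelow; Reduces; stop; again; digitAt; linearDigit;
         linearise; prime; cyclotomic; ppi; seed; ascend; replace; respect)
  renaming (_+_ to _⊕_; -_ to ⊝_; _*_ to _⊗_; _∘_ to _⊚_)
open import Data.Digit using (toDigits; fromDigits)
open import Data.Fin.Base using (Fin; toℕ)
open import Data.Fin.Properties using (toℕ<n)
open import Data.Fin.Subset using (Subset; inside; outside)
open import Data.Integer.Base as ℤ using (ℤ; +_; -[1+_]; 0ℤ; 1ℤ; ∣_∣; +≤+; +<+; -<+)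
import Data.Integer.Properties as ℤ
open import Data.Integer.Tactic.RingSolver using (solve-∀)
open import Data.List.Base
  using (List; []; _∷_; _∷ʳ_; map; length)
open import Data.List.Properties using (map-∘)
open import Data.List.Relation.Unary.All using (All; []; _∷_; all?)
  renaming (map to All-map)
open import Data.List.Relation.Unary.All.Properties using (map⁺)
open import Data.Nat.Base
  using (ℕ; zero; suc; _≤_; _+_; _*_; _∸_; _<_; _%_; _/_; NonZero; >-nonZero⁻¹; z≤n; s≤s)
open import Data.Nat.DivMod
  using (m<n⇒m%n≡m; m<n⇒m/n≡0; [m+kn]%n≡m%n; +-distrib-/-∣ʳ; m*n/n≡m)
open import Data.Nat.Divisibility using (n∣m*n)
open import Data.Nat.Induction using (Acc; acc; <-wellFounded)
open import Data.Nat.ListAction using (sum)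
open import Data.Nat.Primality using (Prime; prime⇒nonZero)
open import Data.Nat.Properties as ℕ using (module ≤-Reasoning)
open import Data.Product.Base using (_×_; ∃-syntax; _,_; proj₁; proj₂)
open import Data.Sum.Base using (_⊎_; inj₁; inj₂)
import Data.Vec.Base as Vec
open import Function.Base using (_∘_)
open import Relation.Binary.PropositionalEquality
  using (_≡_; _≢_; refl; sym; trans; cong; cong₂; subst; module ≡-Reasoning)
open import Relation.Nullary.Decidable.Core using (yes; no)
open import Relation.Nullary.Negation using (¬_; contradiction)

open _≈_

-- Polynomials up to trailing zeros, and their evaluation.

≈-refl : ∀ {f} → f ≈ f
≈-refl = mk≈ λ _ → refl

≈-sym : ∀ {f g} → f ≈ g → g ≈ f
≈-sym f≈g = mk≈ λ i → sym (coeff-≡ f≈g i)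

≈-trans : ∀ {f g h} → f ≈ g → g ≈ h → f ≈ h
≈-trans f≈g g≈h = mk≈ λ i → trans (coeff-≡ f≈g i) (coeff-≡ g≈h i)

∷-cong : ∀ {c d f g} → c ≡ d → f ≈ g → c ∷ f ≈ d ∷ g
∷-cong c≡d f≈g = mk≈ λ { zero → c≡d ; (suc i) → coeff-≡ f≈g i }

∷-≈[] : ∀ {c f} → c ≡ 0ℤ → f ≈ [] → c ∷ f ≈ []
∷-≈[] c≡0 f≈[] = mk≈ λ { zero → c≡0 ; (suc i) → coeff-≡ f≈[] i }

tail-≈ : ∀ {c d f g} → c ∷ f ≈ d ∷ g → f ≈ g
tail-≈ eq = mk≈ (coeff-≡ eq ∘ suc)

tail-≈[] : ∀ {c f} → c ∷ f ≈ [] → f ≈ []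
tail-≈[] eq = mk≈ (coeff-≡ eq ∘ suc)

coeff-⊕ : ∀ f g i → coeff (f ⊕ g) i ≡ coeff f i ℤ.+ coeff g i
coeff-⊕ []      g       i       = sym (ℤ.+-identityˡ _)
coeff-⊕ (c ∷ f) []      i       = sym (ℤ.+-identityʳ _)
coeff-⊕ (c ∷ f) (d ∷ g) zero    = refl
coeff-⊕ (c ∷ f) (d ∷ g) (suc i) = coeff-⊕ f g i

⊕-cong : ∀ {f f′ g g′} → f ≈ f′ → g ≈ g′ → f ⊕ g ≈ f′ ⊕ g′
⊕-cong {f} {f′} {g} {g′} f≈f′ g≈g′ = mk≈ λ i →
  trans (coeff-⊕ f g i)
    (trans (cong₂ ℤ._+_ (coeff-≡ f≈f′ i) (coeff-≡ g≈g′ i)) (sym (coeff-⊕ f′ g′ i)))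

fromBase-x-∷-cong : ∀ d {f g} → f ≈ g → digitPoly d ⊕ x· f ≈ digitPoly d ⊕ x· g
fromBase-x-∷-cong d f≈g = ⊕-cong (≈-refl {digitPoly d}) (∷-cong refl f≈g)

-- Trailing zeros are permitted, so a list that is `≈ []` need not be empty and each of its entries
-- has to be seen to vanish.
eval-≈[] : ∀ {f} n → f ≈ [] → eval f n ≡ 0ℤ
eval-≈[] {[]}    n f≈[] = refl
eval-≈[] {c ∷ f} n f≈[]
  rewrite coeff-≡ f≈[] 0 | eval-≈[] n (tail-≈[] f≈[]) | ℤ.*-zeroʳ n = refl

eval-cong : ∀ {f g} n → f ≈ g → eval f n ≡ eval g n
eval-cong {[]}    {g}     n f≈g = sym (eval-≈[] n (≈-sym f≈g))
eval-cong {c ∷ f} {[]}    n f≈g = eval-≈[] n f≈g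
eval-cong {c ∷ f} {d ∷ g} n f≈g =
  cong₂ (λ c v → c ℤ.+ n ℤ.* v) (coeff-≡ f≈g 0) (eval-cong n (tail-≈ f≈g))

eval-⊕ : ∀ f g n → eval (f ⊕ g) n ≡ eval f n ℤ.+ eval g n
eval-⊕ []      g       n = sym (ℤ.+-identityˡ _)
eval-⊕ (c ∷ f) []      n = sym (ℤ.+-identityʳ _)
eval-⊕ (c ∷ f) (d ∷ g) n rewrite eval-⊕ f g n = lemma c d n (eval f n) (eval g n)
  where
  lemma : ∀ c d n v w → c ℤ.+ d ℤ.+ n ℤ.* (v ℤ.+ w) ≡
                        (c ℤ.+ n ℤ.* v) ℤ.+ (d ℤ.+ n ℤ.* w)
  lemma = solve-∀

eval-⊝ : ∀ f n → eval (⊝ f) n ≡ ℤ.- eval f n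
eval-⊝ []      n = refl
eval-⊝ (c ∷ f) n rewrite eval-⊝ f n = lemma c n (eval f n)
  where
  lemma : ∀ c n v → ℤ.- c ℤ.+ n ℤ.* (ℤ.- v) ≡ ℤ.- (c ℤ.+ n ℤ.* v)
  lemma = solve-∀

eval-scale : ∀ c f n → eval (map (c ℤ.*_) f) n ≡ c ℤ.* eval f n
eval-scale c []      n = sym (ℤ.*-zeroʳ c)
eval-scale c (d ∷ f) n rewrite eval-scale c f n = lemma c d n (eval f n)
  where
  lemma : ∀ c d n v → c ℤ.* d ℤ.+ n ℤ.* (c ℤ.* v) ≡ c ℤ.* (d ℤ.+ n ℤ.* v)
  lemma = solve-∀

eval-⊗ : ∀ f g n → eval (f ⊗ g) n ≡ eval f n ℤ.* eval g n
eval-⊗ []      g n = refl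
eval-⊗ (c ∷ f) g n
  rewrite eval-⊕ (map (c ℤ.*_) g) (x· (f ⊗ g)) n | eval-scale c g n | eval-⊗ f g n
  = lemma c n (eval f n) (eval g n)
  where
  lemma : ∀ c n v w → c ℤ.* w ℤ.+ (0ℤ ℤ.+ n ℤ.* (v ℤ.* w)) ≡ (c ℤ.+ n ℤ.* v) ℤ.* w
  lemma = solve-∀

eval-⊚ : ∀ f g n → eval (f ⊚ g) n ≡ eval f (eval g n)
eval-⊚ []      g n = refl
eval-⊚ (c ∷ f) g n
  rewrite eval-⊕ (constant c) (g ⊗ (f ⊚ g)) n | eval-⊗ g (f ⊚ g) n | eval-⊚ f g n
        | ℤ.*-zeroʳ n | ℤ.+-identityʳ c
  = refl

eval-shift : ∀ a b f → eval (shift a f) (+ (b + a)) ≡ eval f (+ b)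
eval-shift a b f =
  trans (eval-⊚ f (ℤ.- (+ a) ∷ 1ℤ ∷ []) (+ (b + a))) (cong (eval f) (lemma (+ a) (+ b)))
  where
  lemma : ∀ a b → ℤ.- a ℤ.+ (b ℤ.+ a) ℤ.* (1ℤ ℤ.+ (b ℤ.+ a) ℤ.* 0ℤ) ≡ b
  lemma = solve-∀

-- Base-`B` expansions of natural numbers.

value : ℕ → List ℕ → ℕ
value B []       = 0
value B (d ∷ ds) = d + value B ds * B

eval-value : ∀ B ds → eval (map +_ ds) (+ B) ≡ + value B ds
eval-value B []       = refl
eval-value B (d ∷ ds) rewrite eval-value B ds =
  cong (ℤ._+_ (+ d)) (trans (sym (ℤ.pos-* B _)) (cong +_ (ℕ.*-comm B _)))

divMod-unique : ∀ {B m n v w} .{{_ : NonZero B}} → m < B → n < B →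
                m + v * B ≡ n + w * B → m ≡ n × v ≡ w
divMod-unique {B} {m} {n} {v} {w} m<B n<B eq =
  trans (sym (rem m<B v)) (trans (cong (_% B) eq) (rem n<B w)) ,
  trans (sym (quot m<B v)) (trans (cong (_/ B) eq) (quot n<B w))
  where
  rem : ∀ {k} → k < B → ∀ q → (k + q * B) % B ≡ k
  rem k<B q = trans ([m+kn]%n≡m%n _ q B) (m<n⇒m%n≡m k<B)

  quot : ∀ {k} → k < B → ∀ q → (k + q * B) / B ≡ q
  quot k<B q = trans (+-distrib-/-∣ʳ _ (n∣m*n q))
                     (cong₂ _+_ (m<n⇒m/n≡0 k<B) (m*n/n≡m q B))

-- Division with remainder determines the digits one at a time. An exhausted list counts as digit 0
-- with quotient 0, which is why two lists of different lengths are only `≈`.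
value-injective : ∀ {B} .{{_ : NonZero B}} {ds es} → All (_< B) ds → All (_< B) es →
                  value B ds ≡ value B es → map +_ ds ≈ map +_ es
value-injective []         []         eq = ≈-refl
value-injective {B} {es = e ∷ es} [] (e< ∷ es<) eq
  with divMod-unique {v = 0} (ℕ.≤-<-trans z≤n e<) e< eq
... | 0≡e , 0≡v = ≈-sym (∷-≈[] (cong +_ (sym 0≡e)) (≈-sym (value-injective [] es< 0≡v)))
value-injective (d< ∷ ds<) []         eq
  with divMod-unique {w = 0} d< (ℕ.≤-<-trans z≤n d<) eq
... | d≡0 , v≡0 = ∷-≈[] (cong +_ d≡0) (value-injective ds< [] v≡0)
value-injective (d< ∷ ds<) (e< ∷ es<) eq with divMod-unique d< e< eq
... | d≡e , v≡w = ∷-cong (cong +_ d≡e) (value-injective ds< es< v≡w)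

value-<1 : ∀ {ds} → All (_< 1) ds → value 1 ds ≡ 0
value-<1 []              = refl
value-<1 (s≤s z≤n ∷ ds<) rewrite value-<1 ds< = refl

sum≤value : ∀ B .{{_ : NonZero B}} ds → sum ds ≤ value B ds
sum≤value B []       = z≤n
sum≤value B (d ∷ ds) =
  ℕ.+-monoʳ-≤ d (ℕ.≤-trans (sum≤value B ds) (ℕ.m≤m*n (value B ds) B))

-- If the tail had value 0, the whole value would be the single digit `d < B`. So the tail has
-- positive value, and multiplying that by `B ≥ 2` gains strictly over the digit sum of the tail.
sum<value : ∀ {B} .{{_ : NonZero B}} {ds} → 2 ≤ B → All (_< B) ds → B ≤ value B ds →
            sum ds < value B ds
sum<value {suc _} {[]}     2≤B []         ()
sum<value {B}     {d ∷ ds} 2≤B (d< ∷ _) B≤ with value B ds | sum≤value B ds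
... | zero  | _  =
  contradiction (subst (B ≤_) (ℕ.+-identityʳ d) B≤) (ℕ.<⇒≱ d<)
... | suc v | s≤ =
  ℕ.+-monoʳ-< d (ℕ.≤-<-trans s≤ (ℕ.m<m*n (suc v) B 2≤B))

-- The digits are natural numbers rather than elements of `Fin B`, so that they can be compared with
-- the digit values of a base-x representation.
record Expansion (B n : ℕ) : Set where
  field
    digits   : List ℕ
    f-digits : f⟨ B ⟩ n ≡ map +_ digits
    bounded  : All (_< B) digits
    value-≡  : value B digits ≡ n

expansion : ∀ {B} → 2 ≤ B → ∀ n → Expansion B n
expansion {B@(suc (suc _))} _ n = record
  { digits   = map toℕ ds
  ; f-digits = map-∘ ds
  ; bounded  = toℕ-bounded ds
  ; value-≡  = trans (value-toℕ ds) (proj₂ (toDigits B n))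
  }
  where
  ds = proj₁ (toDigits B n)

  toℕ-bounded : ∀ (ds : List (Fin B)) → All (_< B) (map toℕ ds)
  toℕ-bounded []       = []
  toℕ-bounded (d ∷ ds) = toℕ<n d ∷ toℕ-bounded ds

  value-toℕ : ∀ (ds : List (Fin B)) → value B (map toℕ ds) ≡ fromDigits ds
  value-toℕ []       = refl
  value-toℕ (d ∷ ds) = cong (λ v → toℕ d + v * B) (value-toℕ ds)
expansion {1} (s≤s ()) n

-- Base 1 is included: a sum of `n` powers of 1 is `n`. An ascent that starts from base 1 therefore
-- needs no separate treatment.
eval-f : ∀ {b} → 1 ≤ b → ∀ n → eval (f⟨ b ⟩ n) (+ b) ≡ + n
eval-f {1} _   zero    = refl
eval-f {1} 1≤1 (suc n) =
  cong (ℤ._+_ 1ℤ) (trans (ℤ.*-identityˡ (eval (f⟨ 1 ⟩ n) (+ 1))) (eval-f 1≤1 n))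
eval-f {b@(suc (suc _))} _ n =
  trans (cong (λ f → eval f (+ b)) f-digits)
    (trans (eval-value b digits) (cong +_ value-≡))
  where open Expansion (expansion {b} (s≤s (s≤s z≤n)) n)

-- The list `ds` may end in zeros. This matters because a linear top digit `x - B` has the value 0
-- at `B`.
f-unique : ∀ {B} → 2 ≤ B → ∀ {ds} n → All (_< B) ds → value B ds ≡ n →
           f⟨ B ⟩ n ≈ map +_ ds
f-unique {suc _} 2≤B {ds} n ds< eq =
  subst (_≈ map +_ ds) (sym f-digits)
    (value-injective bounded ds< (trans value-≡ (sym eq)))
  where open Expansion (expansion 2≤B n)

-- Termination of the reduction

‖_‖ : Poly → ℕ
‖ f ‖ = sum (map ∣_∣ f)

-- The expansions of neighbouring coefficients overlap and may cancel, so only subadditivity of the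
-- norm is available.
‖⊕‖ : ∀ f g → ‖ f ⊕ g ‖ ≤ ‖ f ‖ + ‖ g ‖
‖⊕‖ []      g       = ℕ.≤-refl
‖⊕‖ (c ∷ f) []      = ℕ.m≤m+n _ 0
‖⊕‖ (c ∷ f) (d ∷ g) = begin
  ∣ c ℤ.+ d ∣ + ‖ f ⊕ g ‖               ≤⟨ ℕ.+-mono-≤ (ℤ.∣i+j∣≤∣i∣+∣j∣ c d) (‖⊕‖ f g) ⟩
  (∣ c ∣ + ∣ d ∣) + (‖ f ‖ + ‖ g ‖)     ≡⟨ ℕ.+-assoc ∣ c ∣ ∣ d ∣ _ ⟩
  ∣ c ∣ + (∣ d ∣ + (‖ f ‖ + ‖ g ‖))     ≡⟨ cong (λ k → ∣ c ∣ + k) (swap ∣ d ∣ ‖ f ‖ ‖ g ‖) ⟩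
  ∣ c ∣ + (‖ f ‖ + (∣ d ∣ + ‖ g ‖))     ≡⟨ ℕ.+-assoc ∣ c ∣ ‖ f ‖ _ ⟨
  (∣ c ∣ + ‖ f ‖) + (∣ d ∣ + ‖ g ‖)     ∎
  where
  open ≤-Reasoning
  swap : ∀ k m n → k + (m + n) ≡ m + (k + n)
  swap k m n = trans (sym (ℕ.+-assoc k m n))
                 (trans (cong (_+ n) (ℕ.+-comm k m)) (ℕ.+-assoc m k n))

‖⊝‖ : ∀ f → ‖ ⊝ f ‖ ≡ ‖ f ‖
‖⊝‖ []      = refl
‖⊝‖ (c ∷ f) = cong₂ _+_ (ℤ.∣-i∣≡∣i∣ c) (‖⊝‖ f)

‖map-+‖ : ∀ ds → ‖ map +_ ds ‖ ≡ sum ds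
‖map-+‖ []       = refl
‖map-+‖ (d ∷ ds) = cong (λ k → d + k) (‖map-+‖ ds)

‖f‖≤ : ∀ {B} → 2 ≤ B → ∀ n → ‖ f⟨ B ⟩ n ‖ ≤ n
‖f‖≤ {B@(suc _)} 2≤B n = begin
  ‖ f⟨ B ⟩ n ‖      ≡⟨ cong ‖_‖ f-digits ⟩
  ‖ map +_ digits ‖ ≡⟨ ‖map-+‖ digits ⟩
  sum digits        ≤⟨ sum≤value B digits ⟩
  value B digits    ≡⟨ value-≡ ⟩
  n                 ∎
  where
  open ≤-Reasoning
  open Expansion (expansion 2≤B n)

‖f‖< : ∀ {B} → 2 ≤ B → ∀ n → B ≤ n → ‖ f⟨ B ⟩ n ‖ < n
‖f‖< {B@(suc _)} 2≤B n B≤n = begin-strict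
  ‖ f⟨ B ⟩ n ‖      ≡⟨ cong ‖_‖ f-digits ⟩
  ‖ map +_ digits ‖ ≡⟨ ‖map-+‖ digits ⟩
  sum digits        <⟨ sum<value 2≤B bounded (subst (B ≤_) (sym value-≡) B≤n) ⟩
  value B digits    ≡⟨ value-≡ ⟩
  n                 ∎
  where
  open ≤-Reasoning
  open Expansion (expansion 2≤B n)

module _ {B : ℕ} (2≤B : 2 ≤ B) where

  ‖expandCoeff‖≤ : ∀ c → ‖ expandCoeff B c ‖ ≤ ∣ c ∣
  ‖expandCoeff‖≤ (+ zero)  = z≤n
  ‖expandCoeff‖≤ (+ suc n) = ‖f‖≤ 2≤B (suc n)
  ‖expandCoeff‖≤ -[1+ n ]  =
    subst (_≤ suc n) (sym (‖⊝‖ (f⟨ B ⟩ (suc n)))) (‖f‖≤ 2≤B (suc n))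

  ‖expandCoeff‖< : ∀ c → B ≤ ∣ c ∣ → ‖ expandCoeff B c ‖ < ∣ c ∣
  ‖expandCoeff‖< (+ zero)  B≤0 = contradiction (ℕ.≤-trans 2≤B B≤0) λ ()
  ‖expandCoeff‖< (+ suc n) B≤n = ‖f‖< 2≤B (suc n) B≤n
  ‖expandCoeff‖< -[1+ n ]  B≤n =
    subst (_< suc n) (sym (‖⊝‖ (f⟨ B ⟩ (suc n)))) (‖f‖< 2≤B (suc n) B≤n)

  ‖expandCoeffs‖≤ : ∀ f → ‖ expandCoeffs B f ‖ ≤ ‖ f ‖
  ‖expandCoeffs‖≤ []      = z≤n
  ‖expandCoeffs‖≤ (c ∷ f) =
    ℕ.≤-trans (‖⊕‖ (expandCoeff B c) _)
      (ℕ.+-mono-≤ (‖expandCoeff‖≤ c) (‖expandCoeffs‖≤ f))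

  -- No coefficient contributes more than its absolute value, so one strict drop suffices; the
  -- recursion looks for the first coefficient that is at least `B` in absolute value.
  ‖expandCoeffs‖< : ∀ f → ¬ CoeffsBelow B f → ‖ expandCoeffs B f ‖ < ‖ f ‖
  ‖expandCoeffs‖< []      ¬below = contradiction [] ¬below
  ‖expandCoeffs‖< (c ∷ f) ¬below with ∣ c ∣ ℕ.<? B
  ... | yes c<B =
    ℕ.≤-<-trans (‖⊕‖ (expandCoeff B c) _)
      (ℕ.+-mono-≤-< (‖expandCoeff‖≤ c) (‖expandCoeffs‖< f (¬below ∘ (c<B ∷_))))
  ... | no  c≮B =
    ℕ.≤-<-trans (‖⊕‖ (expandCoeff B c) _)
      (ℕ.+-mono-<-≤ (‖expandCoeff‖< c (ℕ.≮⇒≥ c≮B)) (‖expandCoeffs‖≤ f))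

  eval-expandCoeff : ∀ c → eval (expandCoeff B c) (+ B) ≡ c
  eval-expandCoeff (+ zero)  = refl
  eval-expandCoeff (+ suc n) = eval-f (ℕ.<⇒≤ 2≤B) (suc n)
  eval-expandCoeff -[1+ n ]  =
    trans (eval-⊝ (f⟨ B ⟩ (suc n)) (+ B)) (cong ℤ.-_ (eval-f (ℕ.<⇒≤ 2≤B) (suc n)))

  eval-expandCoeffs : ∀ f → eval (expandCoeffs B f) (+ B) ≡ eval f (+ B)
  eval-expandCoeffs []      = refl
  eval-expandCoeffs (c ∷ f)
    rewrite eval-⊕ (expandCoeff B c) (x· expandCoeffs B f) (+ B)
          | eval-expandCoeff c | eval-expandCoeffs f
    = cong (ℤ._+_ c) (ℤ.+-identityˡ _)

  reduce : ∀ f → ∃[ h ] Reduces B f h × CoeffsBelow B h × eval h (+ B) ≡ eval f (+ B)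
  reduce f = go f (<-wellFounded _)
    where
    -- The procedure expands once before its first test, so the recursion is on the norm of the
    -- expanded polynomial; a failed test makes the next norm strictly smaller.
    go : ∀ f → Acc _<_ ‖ expandCoeffs B f ‖ →
         ∃[ h ] Reduces B f h × CoeffsBelow B h × eval h (+ B) ≡ eval f (+ B)
    go f (acc rs) with all? (λ c → ∣ c ∣ ℕ.<? B) (expandCoeffs B f)
    ... | yes below = _ , stop below , below , eval-expandCoeffs f
    ... | no ¬below with go (expandCoeffs B f) (rs (‖expandCoeffs‖< _ ¬below))
    ... | h , red , below , eq =
      h , again ¬below red , below , trans eq (eval-expandCoeffs f)

-- Base-x representations

-- Truncated subtraction keeps the values in `ℕ`; on digits within the bound `B` the result agrees
-- with `digitAt B`.
digitValue : ℕ → Digit → ℕ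
digitValue B (nat n)   = n
digitValue B x-[1+ j ] = B ∸ suc j

digitValue-bounded : ∀ {B} → 1 ≤ B → ∀ {d} → d WithinBound B → digitValue B d < B
digitValue-bounded 1≤B {nat n}    n<B = n<B
digitValue-bounded 1≤B {x-[1+ j ]} j<B = ℕ.∸-monoʳ-< (s≤s z≤n) j<B

digitAt-digitValue : ∀ {B d} → d WithinBound B → digitAt B d ≡ + digitValue B d
digitAt-digitValue {d = nat n}        _   = refl
digitAt-digitValue {B} {x-[1+ j ]} j<B =
  trans (ℤ.m-n≡m⊖n B (suc j)) (ℤ.⊖-≥ j<B)

map-digitAt : ∀ {B ds} → All (_WithinBound B) ds →
              map (digitAt B) ds ≡ map +_ (map (digitValue B) ds)
map-digitAt []         = refl
map-digitAt (d< ∷ ds<) = cong₂ _∷_ (digitAt-digitValue d<) (map-digitAt ds<)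

digitValues-bounded : ∀ {B} → 1 ≤ B → ∀ {ds} → All (_WithinBound B) ds →
                      All (_< B) (map (digitValue B) ds)
digitValues-bounded 1≤B ds< = map⁺ (All-map (digitValue-bounded 1≤B) ds<)

eval-digitPoly : ∀ B d → eval (digitPoly d) (+ B) ≡ digitAt B d
eval-digitPoly B (nat n)    = trans (cong (ℤ._+_ (+ n)) (ℤ.*-zeroʳ (+ B))) (ℤ.+-identityʳ _)
eval-digitPoly B x-[1+ j ] = lemma -[1+ j ] (+ B)
  where
  lemma : ∀ c b → c ℤ.+ b ℤ.* (1ℤ ℤ.+ b ℤ.* 0ℤ) ≡ b ℤ.+ c
  lemma = solve-∀

eval-fromBase-x : ∀ B ds → eval (fromBase-x ds) (+ B) ≡ eval (map (digitAt B) ds) (+ B)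
eval-fromBase-x B []       = refl
eval-fromBase-x B (d ∷ ds)
  rewrite eval-⊕ (digitPoly d) (x· fromBase-x ds) (+ B)
        | eval-digitPoly B d | eval-fromBase-x B ds
  = cong (ℤ._+_ (digitAt B d)) (ℤ.+-identityˡ _)

value-digits : ∀ {B ds} → All (_WithinBound B) ds →
               + value B (map (digitValue B) ds) ≡ eval (fromBase-x ds) (+ B)
value-digits {B} {ds} ds< = begin
  + value B (map (digitValue B) ds)               ≡⟨ eval-value B (map (digitValue B) ds) ⟨
  eval (map +_ (map (digitValue B) ds)) (+ B)     ≡⟨ cong (λ f → eval f (+ B)) (map-digitAt ds<) ⟨
  eval (map (digitAt B) ds) (+ B)                 ≡⟨ eval-fromBase-x B ds ⟨
  eval (fromBase-x ds) (+ B)                      ∎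
  where open ≡-Reasoning

-- Used in both directions of the argument: it identifies the output of the ascent, and it recovers
-- `f⟨ b ⟩ p` from the digits of a PPI-polynomial with value `p` at `b`.
f-digitAt : ∀ {B} → 2 ≤ B → ∀ {ds} n → All (_WithinBound B) ds →
            eval (fromBase-x ds) (+ B) ≡ + n → f⟨ B ⟩ n ≈ map (digitAt B) ds
f-digitAt {B} 2≤B n ds< eq =
  subst (f⟨ B ⟩ n ≈_) (sym (map-digitAt ds<))
    (f-unique 2≤B n (digitValues-bounded (ℕ.<⇒≤ 2≤B) ds<)
      (ℤ.+-injective (trans (value-digits ds<) eq)))

-- Conversion to base x can leave zero digits at the top, whereas a representation must end in a
-- nonzero digit. The zero polynomial has no such digit and forms the first alternative.
trim : ∀ {P : Digit → Set} {ds} → All P ds →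
       fromBase-x ds ≈ [] ⊎
       ∃[ ds′ ] ∃[ d ] fromBase-x (ds′ ∷ʳ d) ≈ fromBase-x ds × All P (ds′ ∷ʳ d) × d ≢ nat 0
trim []                   = inj₁ ≈-refl
trim {ds = d ∷ ds} (pd ∷ pds) with trim pds
... | inj₂ (ds′ , e , eq , ps , e≢0) =
  inj₂ (d ∷ ds′ , e , fromBase-x-∷-cong d eq , pd ∷ ps , e≢0)
trim {ds = nat zero ∷ ds} (pd ∷ pds) | inj₁ eq =
  inj₁ (≈-trans (fromBase-x-∷-cong (nat 0) eq) (∷-≈[] refl ≈-refl))
trim {ds = d@(nat (suc _)) ∷ ds} (pd ∷ pds) | inj₁ eq =
  inj₂ ([] , d , fromBase-x-∷-cong d (≈-sym eq) , pd ∷ [] , λ ())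
trim {ds = d@(x-[1+ _ ]) ∷ ds} (pd ∷ pds) | inj₁ eq =
  inj₂ ([] , d , fromBase-x-∷-cong d (≈-sym eq) , pd ∷ [] , λ ())

-- With `v ≤ -1` the sum would be at most `n - B < 0`.
nonNegative-quotient : ∀ {B n v} → n < B → 0ℤ ℤ.≤ + n ℤ.+ + B ℤ.* v → 0ℤ ℤ.≤ v
nonNegative-quotient {B} {n} {v} n<B 0≤ =
  subst (0ℤ ℤ.≤_) (ℤ.pred-suc v) (ℤ.i<j⇒i≤pred[j] (ℤ.*-cancelˡ-<-nonNeg (+ B) (begin-strict
    + B ℤ.* 0ℤ           ≡⟨ ℤ.*-zeroʳ (+ B) ⟩
    0ℤ                   ≤⟨ 0≤ ⟩
    + n ℤ.+ + B ℤ.* v    <⟨ ℤ.+-monoˡ-< (+ B ℤ.* v) (+<+ n<B) ⟩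
    + B ℤ.+ + B ℤ.* v    ≡⟨ ℤ.*-suc (+ B) v ⟨
    + B ℤ.* ℤ.suc v      ∎)))
  where open ℤ.≤-Reasoning

-- Strict positivity leaves room for the borrow: the predecessor of `v` is still nonnegative.
positive-quotient : ∀ {B j v} → 0ℤ ℤ.≤ -[1+ j ] ℤ.+ + B ℤ.* v → 0ℤ ℤ.< v
positive-quotient {B} {j} {v} 0≤ = ℤ.*-cancelˡ-<-nonNeg (+ B) (begin-strict
  + B ℤ.* 0ℤ                ≡⟨ ℤ.*-zeroʳ (+ B) ⟩
  0ℤ                        ≤⟨ 0≤ ⟩
  -[1+ j ] ℤ.+ + B ℤ.* v    <⟨ ℤ.+-monoˡ-< (+ B ℤ.* v) (-<+ {j} {0}) ⟩
  0ℤ ℤ.+ + B ℤ.* v          ≡⟨ ℤ.+-identityˡ _ ⟩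
  + B ℤ.* v                 ∎)
  where open ℤ.≤-Reasoning

leadingDigit : ℤ → Digit
leadingDigit (+ n)    = nat n
leadingDigit -[1+ j ] = x-[1+ j ]

leadingDigit-within : ∀ {B} d → ∣ d ∣ < B → leadingDigit d WithinBound B
leadingDigit-within (+ n)    d<B = d<B
leadingDigit-within -[1+ j ] d<B = ℕ.<⇒≤ d<B

-- A borrow can lower a coefficient from `-(B - 1)` to `-B`, but the digit `x - B` is still allowed.
-- For this reason the conversion bounds its first coefficient through `leadingDigit` and not by its
-- absolute value.
leadingDigit-pred : ∀ {B} d → ∣ d ∣ < B → leadingDigit (ℤ.pred d) WithinBound B
leadingDigit-pred (+ zero)  d<B = d<B
leadingDigit-pred (+ suc n) d<B = ℕ.<⇒≤ d<B
leadingDigit-pred -[1+ j ]  d<B = d<B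

-- A negative coefficient -j becomes the digit x - j and borrows 1 from the next
-- coefficient; a nonnegative value at B ensures that the last borrow is covered.
toBase-x : ∀ {B} c f → leadingDigit c WithinBound B → CoeffsBelow B f →
           0ℤ ℤ.≤ eval (c ∷ f) (+ B) →
           ∃[ ds ] fromBase-x ds ≈ c ∷ f × All (_WithinBound B) ds
toBase-x (+ n) [] n<B _ _ =
  nat n ∷ [] , ∷-cong (ℤ.+-identityʳ (+ n)) ≈-refl , n<B ∷ []
toBase-x {B} (+ n) (d ∷ f) n<B (d<B ∷ f<B) 0≤
  with toBase-x d f (leadingDigit-within d d<B) f<B (nonNegative-quotient n<B 0≤)
... | ds , eq , ds< =
  nat n ∷ ds ,
  ≈-trans (fromBase-x-∷-cong (nat n) eq) (∷-cong (ℤ.+-identityʳ (+ n)) ≈-refl) ,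
  n<B ∷ ds<
toBase-x {B} -[1+ j ] [] _ _ 0≤ =
  contradiction (positive-quotient {B} {j} {0ℤ} 0≤) (ℤ.<-irrefl refl)
toBase-x {B} -[1+ j ] (d ∷ f) j<B (d<B ∷ f<B) 0≤
  with toBase-x (ℤ.pred d) f (leadingDigit-pred d d<B) f<B
         (subst (0ℤ ℤ.≤_) (sym (ℤ.pred-+ d (+ B ℤ.* eval f (+ B))))
           (ℤ.i<j⇒i≤pred[j] (positive-quotient {B} {j} 0≤)))
... | ds , eq , ds< =
  x-[1+ j ] ∷ ds ,
  ≈-trans (fromBase-x-∷-cong x-[1+ j ] eq)
    (∷-cong (ℤ.+-identityʳ -[1+ j ]) (∷-cong (ℤ.suc-pred d) ≈-refl)) ,
  j<B ∷ ds<

baseXRepresentation : ∀ {B h} → CoeffsBelow B h → 0ℤ ℤ.< eval h (+ B) →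
                      ∃[ ds ] BaseXRepresentation h ds × All (_WithinBound B) ds
baseXRepresentation {h = []}    _           0<0 = contradiction 0<0 (ℤ.<-irrefl refl)
baseXRepresentation {B} {c ∷ f} (c<B ∷ f<B) 0<
  with toBase-x c f (leadingDigit-within c c<B) f<B (ℤ.<⇒≤ 0<)
... | ds , eq , ds< with trim ds<
... | inj₁ ds≈[] =
  contradiction 0< (ℤ.<-irrefl (sym (eval-≈[] (+ B) (≈-trans (≈-sym eq) ds≈[]))))
... | inj₂ (ds′ , d , eq′ , ds′< , d≢0) =
  ds′ ∷ʳ d ,
  record { represents = ≈-trans eq′ eq ; top-nonzero = ds′ , d , refl , d≢0 } ,
  ds′<

-- Correctness of the ascent procedure.

ascent : ∀ {p} → 1 ≤ p → ∀ {a b} → 1 ≤ a → 1 ≤ b → Ascent a b (f⟨ b ⟩ p) (f⟨ b + a ⟩ p)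
ascent {p} 1≤p {a} {b} 1≤a 1≤b
  -- The two bounds add up to `2 ≤ b + a`; in base 1 expanding a coefficient would not lower the
  -- digit sum.
  with reduce (ℕ.+-mono-≤ 1≤b 1≤a) (shift a (f⟨ b ⟩ p))
... | h , red , below , eval-≡
  with eval-h ← trans eval-≡ (trans (eval-shift a b (f⟨ b ⟩ p)) (eval-f 1≤b p))
  with baseXRepresentation below (subst (0ℤ ℤ.<_) (sym eval-h) (+<+ 1≤p))
... | ds , rep , ds< = record
  { reduces    = red
  ; represents = rep
  ; result     = f-digitAt (ℕ.+-mono-≤ 1≤b 1≤a) p ds<
                   (trans (eval-cong (+ (b + a)) (BaseXRepresentation.represents rep)) eval-h)
  }

-- Replacement of coefficients by linear digits, and generation of the family.

linearDigits : (ds : List Digit) → Subset (length ds)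
linearDigits []               = Vec.[]
linearDigits (nat _ ∷ ds)     = outside Vec.∷ linearDigits ds
linearDigits (x-[1+ _ ] ∷ ds) = inside  Vec.∷ linearDigits ds

-- The digit `x - j` has the value `b - j` at `b`, and replacing that coefficient gives
-- `x - (b - (b - j))`, the original digit.
linearise-linearDigits : ∀ b {f} ds → f ≈ map (digitAt b) ds →
                         linearise b (linearDigits ds) f ≈ fromBase-x ds
linearise-linearDigits b []           f≈ = f≈
linearise-linearDigits b {[]} (nat n ∷ ds) f≈ =
  ∷-cong (trans (coeff-≡ f≈ 0) (sym (ℤ.+-identityʳ (+ n))))
    (linearise-linearDigits b ds (≈-sym (tail-≈[] (≈-sym f≈))))
linearise-linearDigits b {c ∷ f} (nat n ∷ ds) f≈ =
  ∷-cong (trans (coeff-≡ f≈ 0) (sym (ℤ.+-identityʳ (+ n))))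
    (linearise-linearDigits b ds (tail-≈ f≈))
linearise-linearDigits b {f} (x-[1+ j ] ∷ ds) f≈ = body f f≈
  where
  linearDigit-≈ : ∀ {c} → c ≡ digitAt b x-[1+ j ] → linearDigit b c ≈ digitPoly x-[1+ j ]
  linearDigit-≈ refl = ∷-cong (lemma (+ b) (+ suc j)) ≈-refl
    where
    lemma : ∀ b i → ℤ.- (b ℤ.- (b ℤ.- i)) ≡ ℤ.- i
    lemma = solve-∀

  body : ∀ f → f ≈ map (digitAt b) (x-[1+ j ] ∷ ds) →
         linearise b (inside Vec.∷ linearDigits ds) f ≈ fromBase-x (x-[1+ j ] ∷ ds)
  -- Past the end of `f` the coefficient is an implicit 0, which forces the digit to be `x - b`.
  body []      f≈ = ⊕-cong (linearDigit-≈ (coeff-≡ f≈ 0))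
    (∷-cong refl (linearise-linearDigits b ds (≈-sym (tail-≈[] (≈-sym f≈)))))
  body (c ∷ f) f≈ = ⊕-cong (linearDigit-≈ (coeff-≡ f≈ 0))
    (∷-cong refl (linearise-linearDigits b ds (tail-≈ f≈)))

WithinBound-mono : ∀ {a b} → a ≤ b → ∀ {d} → d WithinBound a → d WithinBound b
WithinBound-mono a≤b {nat _}     n<a = ℕ.≤-trans n<a a≤b
WithinBound-mono a≤b {x-[1+ _ ]} j<a = ℕ.≤-trans j<a a≤b

generated-f : ∀ {p} → 1 ≤ p → ∀ {b} → 1 ≤ b → Generated p (f⟨ b ⟩ p)
generated-f 1≤p {1}           _ = seed
-- A single ascent from base 1 by `suc k` reaches the base `suc (suc k)`.
generated-f 1≤p {suc (suc k)} _ =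
  ascend {a = suc k} {1} (s≤s z≤n) (s≤s z≤n) seed (ascent 1≤p (s≤s z≤n) (s≤s z≤n))

generated : ∀ {p g} → 1 ≤ p → 𝓕 p g → Generated p g
-- In base `p + 1` the number `p` is a single digit, so the constant polynomial is `f⟨ suc p ⟩ p`.
generated {p} 1≤p (prime g≈p) =
  respect (≈-trans (f-unique (s≤s 1≤p) p (ℕ.n<1+n p ∷ []) (ℕ.+-identityʳ p)) (≈-sym g≈p))
    (generated-f 1≤p {suc p} (s≤s z≤n))
generated 1≤p (cyclotomic g≈Φ) = respect (≈-sym g≈Φ) seed
generated {p} {g} 1≤p (ppi {a} {+ b} _ ((1≤a , ds , rep , ds<a) , _) (+≤+ a≤b) eval-≡) =
  respect (≈-trans (linearise-linearDigits b ds (f-digitAt 2≤b p ds<b eval-ds)) represents)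
    (replace 1≤b (linearDigits ds) (generated-f 1≤p 1≤b))
  where
  open BaseXRepresentation rep

  1≤b : 1 ≤ b
  1≤b = ℕ.≤-trans 1≤a a≤b

  ds<b : All (_WithinBound b) ds
  ds<b = All-map (WithinBound-mono a≤b) ds<a

  eval-ds : eval (fromBase-x ds) (+ b) ≡ + p
  eval-ds = trans (eval-cong (+ b) represents) eval-≡

  value-ds : value b (map (digitValue b) ds) ≡ p
  value-ds = ℤ.+-injective (trans (value-digits ds<b) eval-ds)

  -- In base 1 every digit within the bound has the value 0, so the total could not be `p ≥ 1`.
  -- Excluding this case matters because `f⟨ 1 ⟩` is not a digit expansion.
  b≢1 : b ≢ 1
  b≢1 refl = ℕ.<⇒≢ 1≤p (trans (sym (value-<1 (digitValues-bounded 1≤b ds<b))) value-ds)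

  2≤b : 2 ≤ b
  2≤b = ℕ.≤∧≢⇒< 1≤b (b≢1 ∘ sym)

theorem7 : ∀ (p : ℕ) → Prime p →
    (∀ (a b : ℕ) → 1 ≤ a → 1 ≤ b → Ascent a b (f⟨ b ⟩ p) (f⟨ b + a ⟩ p)) ×
    (∀ (g : Poly) → 𝓕 p g → Generated p g)
theorem7 p p-prime =
  (λ a b 1≤a 1≤b → ascent 1≤p 1≤a 1≤b) , (λ g → generated 1≤p)
  where
  1≤p : 1 ≤ p
  1≤p = >-nonZero⁻¹ p {{prime⇒nonZero p-prime}}
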